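{- Let $G$ be a near-triangulation that does not contain the complete graph $K_4$ as an induced subgraph. Then $G$ is $3$-colourable if and only if $G$ is word-representable.
   Context: A graph $G=(V,E)$ is word-representable if there exists a word $w$ over the alphabet $V$ such that for all distinct $x,y\in V$, the letters $x$ and $y$ alternate in $w$ if and only if $(x,y)\in E$. A near-triangulation is a (finite) planar graph, given with a plane embedding, in which every bounded (inner) face is a triangle; the outer face need not be a triangle. A graph is $3$-colourable if its vertices can be coloured with at most $3$ colours so that adjacent vertices receive different colours. -}

module Defs where

open import Data.Fin.Base using (Fin)
open import Data.Fin.Properties using (_≟_; _<?_)
open import Data.List.Base
  using (List; []; _∷_; length; filter; allFin; cartesianProduct)
open import Data.List.Membership.Propositional using (_∈_)
open import Data.List.Relation.Unary.Linked using (Linked)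
open import Data.Nat.Base using (ℕ; _+_)
open import Data.Nat.GeneralisedArithmetic using (iterate)
open import Data.Product.Base using (∃; ∃-syntax; _×_; _,_)
open import Data.Sum.Base using (_⊎_; inj₁; inj₂)
open import Function.Bundles using (_⇔_)
open import Function.Definitions using (Injective; StrictlySurjective)
open import Level using (0ℓ)
open import Relation.Binary.Core using (Rel)
open import Relation.Binary.Definitions using (Decidable; Symmetric)
open import Relation.Binary.Construct.Closure.Equivalence using (EqClosure)
open import Relation.Binary.Construct.Closure.ReflexiveTransitive using (Star)
open import Relation.Binary.PropositionalEquality using (_≡_; _≢_; ≢-sym; refl)
open import Relation.Nullary using (¬_; ¬?; _×-dec_; _⊎-dec_)

-- Finite simple graphs on the vertex set Fin n.
record Graph (n : ℕ) : Set₁ where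
  field
    Adj        : Rel (Fin n) 0ℓ
    adj?       : Decidable Adj
    adj-sym    : Symmetric Adj
    adj-irrefl : ∀ {v} → ¬ Adj v v

  Isolated : Fin n → Set
  Isolated v = ∀ u → ¬ Adj v u

  #edges : ℕ
  #edges = length (filter (λ (u , v) → (u <? v) ×-dec adj? u v)
                          (cartesianProduct (allFin n) (allFin n)))

K : ∀ n → Graph n
K n = record
  { Adj        = _≢_
  ; adj?       = λ u v → ¬? (u ≟ v)
  ; adj-sym    = ≢-sym
  ; adj-irrefl = λ v≢v → v≢v refl
  }

InducedSubgraph : ∀ {m n} → Graph m → Graph n → Set
InducedSubgraph {m} {n} H G =
  ∃[ f ] Injective {A = Fin m} {B = Fin n} _≡_ _≡_ f
       × (∀ u v → Graph.Adj H u v ⇔ Graph.Adj G (f u) (f v))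

Colourable : ∀ {n} → ℕ → Graph n → Set
Colourable {n} k G =
  ∃ λ (c : Fin n → Fin k) → ∀ u v → Graph.Adj G u v → c u ≢ c v

-- After deleting all letters other than x and y from w, what is left has the
-- form xyxy… or yxyx… (of either parity): no two consecutive letters are equal.
Alternate : ∀ {n} → Fin n → Fin n → List (Fin n) → Set
Alternate x y w = Linked _≢_ (filter (λ z → (z ≟ x) ⊎-dec (z ≟ y)) w)

WordRepresentable : ∀ {n} → Graph n → Set
WordRepresentable {n} G =
  ∃ λ (w : List (Fin n)) →
    ∀ x y → x ≢ y → Alternate x y w ⇔ Graph.Adj G x y

HasComponents : ∀ {n} → Graph n → ℕ → Set
HasComponents {n} G c =
  ∃ λ (comp : Fin n → Fin c) →
    StrictlySurjective _≡_ comp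
    × (∀ u v → comp u ≡ comp v ⇔ Star (Graph.Adj G) u v)

-- A rotation system for G whose boundary walks are grouped into faces.  As G need
-- not be connected, a face may have several boundary walks.
record FacedRotationSystem {n : ℕ} (G : Graph n) : Set where
  open Graph G
  field
    -- next v u is the neighbour of v that follows u in the cyclic order of the
    -- edges drawn around v.  Its value is irrelevant unless u is adjacent to v.
    next        : Fin n → Fin n → Fin n
    next-adj    : ∀ {v u} → Adj v u → Adj v (next v u)
    next-cyclic : ∀ {v u w} → Adj v u → Adj v w →
                  ∃[ k ] iterate (next v) u k ≡ w

    #faces : ℕ

    -- face u v is the face on a fixed side of the edge traversed from u to v;
    -- the walk along its boundary continues from v to next v u.  Its value is
    -- irrelevant unless u and v are adjacent.
    face      : Fin n → Fin n → Fin #faces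
    face-walk : ∀ {u v} → Adj u v → face u v ≡ face v (next v u)

    -- The face in which an isolated vertex lies (irrelevant for other vertices).
    face-isolated : Fin n → Fin #faces

  data Incident : Fin n → Fin #faces → Set where
    corner : ∀ {v u} → Adj v u → Incident v (face v u)
    lone   : ∀ {v} → Isolated v → Incident v (face-isolated v)

  data Touch : Rel (Fin n ⊎ Fin #faces) 0ℓ where
    touch : ∀ {v f} → Incident v f → Touch (inj₁ v) (inj₂ f)

  -- The whole boundary of f is one closed walk a → b → c → a.
  IsTriangle : Fin #faces → Set
  IsTriangle f =
    ∃[ a ] ∃[ b ] ∃[ c ]
      Adj a b × Adj b c × Adj c a
      × (∀ u v → Adj u v →
           face u v ≡ f ⇔ (u , v) ∈ (a , b) ∷ (b , c) ∷ (c , a) ∷ [])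
      × (∀ v → Isolated v → face-isolated v ≢ f)

-- Plane embeddings, up to homeomorphism, in combinatorial form.
--
-- Let b be the number of boundary walks (an isolated vertex counting as one), and
-- V, E, F, C the numbers of vertices, edges, faces and components.  Always
-- V - E + b ≤ 2C, with equality iff each component has genus 0.  Connectedness
-- gives b ≥ C + F - 1, with equality iff the components and faces, joined by the
-- boundary walks, form a tree.  Hence V + F ≤ 1 + C + E, with equality iff the
-- surface obtained by gluing in the faces is a sphere.  The outer face is the one
-- made unbounded.
record PlaneEmbedding {n : ℕ} (G : Graph n) : Set where
  field
    system : FacedRotationSystem G
  open FacedRotationSystem system public
  field
    outer       : Fin #faces
    connected   : ∀ s t → EqClosure Touch s t
    #components : ℕ
    components  : HasComponents G #components
    euler       : n + #faces ≡ 1 + #components + Graph.#edges G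

IsNearTriangulation : ∀ {n} {G : Graph n} → PlaneEmbedding G → Set
IsNearTriangulation P = ∀ f → f ≢ outer → IsTriangle f
  where open PlaneEmbedding P

{-# OPTIONS --safe #-}

-- Suppose w represents G.  The first occurrences in w order the vertices, and the
-- letters of a triangle recur in w in that order cyclically.  If xuv and yvu were
-- triangles with these cyclic orders, then w would run cyclically through u, y,
-- v, x, so that x and y would be adjacent and u, v, x, y would span a K₄.  Hence
-- w turns every triangle on the edge uv the same way, and the value ±1 mod 3
-- recording it is an antisymmetric function of uv that sums to 0 over each
-- triangle.  A near-triangulation has no first cohomology relative to its
-- triangles, so this function is the difference of a function on the vertices,
-- which is a 3-colouring because ±1 is nonzero.
--
-- Conversely, from a 3-colouring take one block for each vertex v.  Every block
-- contains each letter twice and restricts to uvuv on an edge uv with the colour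
-- of u below that of v, while the non-edges at v (if v has the middle colour,
-- those within its colour class) fail to alternate in the block of v.
module Submission where

open import Defs
open import Data.Bool.Base using (Bool; true; false; if_then_else_)
import Data.Bool.Properties as Bool
open import Data.Fin.Base as Fin
  using (Fin; zero; suc; toℕ; splitAt; join; combine; funToFin; finToFun)
open import Data.Fin.Patterns using (0F; 1F; 2F; 3F)
open import Data.Fin.Properties
  using (_≟_; _<?_; all?; any?; <-cmp; injective⇒≤; punchOut-injective;
         finToFun-funToFin; funToFin-finToFin; splitAt-join)
open import Data.List.Base
  using (List; []; _∷_; [_]; _++_; length; lookup; filter; map; concatMap; allFin; cartesianProduct)
import Data.List.Membership.DecPropositional as DecMembership
open import Data.List.Membership.Propositional using (_∈_; _∉_)
open import Data.List.Membership.Propositional.Properties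
  using (∈-allFin; ∈-filter⁺; ∈-filter⁻; ∈-cartesianProduct⁺; ∈-++⁺ʳ)
open import Data.List.Properties
  using (filter-++; filter-≐; filter-none; filter-accept; filter-reject; ≡-dec; length-removeAt′)
import Data.List.Relation.Unary.All as All
open import Data.List.Relation.Unary.AllPairs using (_∷_)
open import Data.List.Relation.Unary.Any as Any using (here; there; index; _─_)
open import Data.List.Relation.Unary.Any.Properties using (lookup-index)
open import Data.List.Relation.Unary.Linked as Linked using (Linked; []; [-]; _∷_; linked?; tail)
import Data.List.Relation.Unary.Linked.Properties as Linkedₚ
open import Data.List.Relation.Unary.Unique.Propositional using (Unique)
import Data.List.Relation.Unary.Unique.Propositional.Properties as Unique
open import Data.Maybe.Base using (Maybe; just; nothing)
import Data.Maybe.Properties as Maybe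
open import Data.Nat.Base using (ℕ; zero; suc; _+_; _∸_; _^_; _≤_; _<_; s≤s⁻¹)
open import Data.Nat.DivMod using (_mod_)
open import Data.Nat.GeneralisedArithmetic using (iterate)
import Data.Nat.Properties as ℕₚ
open import Data.Product.Base using (∃; ∃₂; ∃-syntax; _×_; _,_; proj₁; proj₂; uncurry)
import Data.Product.Properties as Product
open import Data.Sum.Base using (_⊎_; inj₁; inj₂; [_,_]′; swap)
open import Function.Base using (_∘_; id)
open import Function.Bundles using (_⇔_; mk⇔; Equivalence)
open import Function.Definitions using (Injective)
open import Relation.Binary.Construct.Closure.Equivalence using (EqClosure)
open import Relation.Binary.Construct.Closure.ReflexiveTransitive using (Star; ε; _◅_)
open import Relation.Binary.Construct.Closure.Symmetric using (fwd; bwd)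
open import Relation.Binary.Definitions using (DecidableEquality; tri<; tri≈; tri>)
open import Relation.Binary.PropositionalEquality
  using (_≡_; _≢_; _≗_; refl; sym; trans; cong; cong₂; subst; subst₂; ≢-sym; module ≡-Reasoning)
open import Relation.Nullary using (¬_; Dec; does; yes; no; contradiction; ¬?; _×-dec_; _⊎-dec_)
open import Relation.Nullary.Decidable
  using (from-yes; decidable-stable; _→-dec_; dec-true; dec-false)
open import Relation.Unary using (Pred) renaming (Decidable to Decidable₁)

open Equivalence using (to; from)

module _ {a} {A : Set a} (_≟_ : DecidableEquality A) where

  -- Stated over any decidable equality because it is applied both to words of vertices, where it is
  -- the filter in `Alternate`, and to words of types.
  project : A → A → List A → List A
  project x y = filter (λ z → (z ≟ x) ⊎-dec (z ≟ y))

-- Words representing a graph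

-- Alt x y w: x and y alternate in w, and y does not come first.
data Alt {n} (x y : Fin n) : List (Fin n) → Set where
  []   : Alt x y []
  here : ∀ {w} → Alt y x w → Alt x y (x ∷ w)
  skip : ∀ {z w} → z ≢ x → z ≢ y → Alt x y w → Alt x y (z ∷ w)

module _ {n} {x y : Fin n} (x≢y : x ≢ y) where

  -- The prefixed letter stands for the one of `x`, `y` read last. Reading the other one exchanges
  -- the two claims, so they are proved together.
  Linked⇒Alt : ∀ w → (Linked _≢_ (x ∷ project _≟_ x y w) → Alt y x w) ×
                     (Linked _≢_ (y ∷ project _≟_ x y w) → Alt x y w)
  Linked⇒Alt [] = (λ _ → []) , (λ _ → [])
  Linked⇒Alt (z ∷ w) with z ≟ x | z ≟ y
  ... | yes refl | yes refl = contradiction refl x≢y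
  ... | yes refl | no  _    =
    (λ { (x≢x ∷ _) → contradiction refl x≢x }) , (λ { (_ ∷ l) → here (proj₁ (Linked⇒Alt w) l) })
  ... | no  _    | yes refl =
    (λ { (_ ∷ l) → here (proj₂ (Linked⇒Alt w) l) }) , (λ { (y≢y ∷ _) → contradiction refl y≢y })
  ... | no  z≢x  | no  z≢y  =
    skip z≢y z≢x ∘ proj₁ (Linked⇒Alt w) , skip z≢x z≢y ∘ proj₂ (Linked⇒Alt w)

  Alternate⇒Alt : ∀ w → Alternate x y w → Alt x y w ⊎ Alt y x w
  Alternate⇒Alt [] _ = inj₁ []
  Alternate⇒Alt (z ∷ w) with z ≟ x | z ≟ y
  ... | yes refl | _        = λ l → inj₁ (here (proj₁ (Linked⇒Alt w) l))
  ... | no  _    | yes refl = λ l → inj₂ (here (proj₂ (Linked⇒Alt w) l))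
  ... | no  z≢x  | no  z≢y  =
    [ inj₁ ∘ skip z≢x z≢y , inj₂ ∘ skip z≢y z≢x ]′ ∘ Alternate⇒Alt w

  Alt⇒Linked : ∀ w → (Alt y x w → Linked _≢_ (x ∷ project _≟_ x y w)) ×
                     (Alt x y w → Linked _≢_ (y ∷ project _≟_ x y w))
  Alt⇒Linked [] = (λ _ → [-]) , (λ _ → [-])
  Alt⇒Linked (z ∷ w) with z ≟ x | z ≟ y
  ... | yes refl | yes refl = contradiction refl x≢y
  ... | yes refl | no  _    =
    (λ { (here _) → contradiction refl x≢y ; (skip _ x≢x _) → contradiction refl x≢x }) ,
    (λ { (here a) → ≢-sym x≢y ∷ proj₁ (Alt⇒Linked w) a ; (skip x≢x _ _) → contradiction refl x≢x })
  ... | no  _    | yes refl =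
    (λ { (here a) → x≢y ∷ proj₂ (Alt⇒Linked w) a ; (skip y≢y _ _) → contradiction refl y≢y }) ,
    (λ { (here _) → contradiction refl x≢y ; (skip _ y≢y _) → contradiction refl y≢y })
  ... | no  z≢x  | no  z≢y  =
    (λ { (here _) → contradiction refl z≢y ; (skip _ _ a) → proj₁ (Alt⇒Linked w) a }) ,
    (λ { (here _) → contradiction refl z≢x ; (skip _ _ a) → proj₂ (Alt⇒Linked w) a })

  Alt⇒Alternate : ∀ {w} → Alt x y w → Alternate x y w
  Alt⇒Alternate {w} a = tail (proj₂ (Alt⇒Linked w) a)

AltPair : ∀ {n} → Fin n → Fin n → List (Fin n) → Set
AltPair x y w = x ≢ y × Alt x y w

AltPair-head : ∀ {n} {x y : Fin n} {w} → AltPair x y (x ∷ w) → AltPair y x w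
AltPair-head (x≢y , here a)       = ≢-sym x≢y , a
AltPair-head (x≢y , skip x≢x _ _) = contradiction refl x≢x

-- While `x` is awaited, `y` cannot be read. Repeated use below shows that a letter other than a is
-- none of b, c, d either.
AltPair-tail : ∀ {n} {x y z : Fin n} {w} → z ≢ x → AltPair x y (z ∷ w) → z ≢ y × AltPair x y w
AltPair-tail z≢x (x≢y , here _)       = contradiction refl z≢x
AltPair-tail z≢x (x≢y , skip _ z≢y a) = z≢y , x≢y , a

-- In both lemmas the next letters are expected in the order a, b, c, d, and the
-- word runs cyclically through them, so reading a exchanges the two lemmas.
mutual
  Alt-bd : ∀ {n} {a b c d : Fin n} w → AltPair a b w → AltPair a c w → AltPair a d w →
    AltPair b c w → AltPair c d w → Alt b d w
  Alt-bd [] _ _ _ _ _ = []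
  Alt-bd {a = a} (z ∷ w) ab ac ad bc cd with z ≟ a
  ... | yes refl =
    skip (proj₁ ab) (proj₁ ad)
      (Alt-ac w (proj₂ (AltPair-tail (proj₁ ab) bc)) (AltPair-head ab)
                (proj₂ (AltPair-tail (proj₁ ac) cd)) (AltPair-head ac) (AltPair-head ad))
  ... | no z≢a =
    let z≢b , ab′ = AltPair-tail z≢a ab
        z≢c , ac′ = AltPair-tail z≢a ac
        z≢d , ad′ = AltPair-tail z≢a ad
    in skip z≢b z≢d (Alt-bd w ab′ ac′ ad′
         (proj₂ (AltPair-tail z≢b bc)) (proj₂ (AltPair-tail z≢c cd)))

  Alt-ac : ∀ {n} {a b c d : Fin n} w → AltPair a b w → AltPair a d w → AltPair b c w →
    AltPair b d w → AltPair c d w → Alt a c w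
  Alt-ac [] _ _ _ _ _ = []
  Alt-ac {a = a} (z ∷ w) ab ad bc bd cd with z ≟ a
  ... | yes refl =
    here (Alt-bd w (proj₂ (AltPair-tail (proj₁ ab) bc)) (proj₂ (AltPair-tail (proj₁ ab) bd))
                   (AltPair-head ab) (proj₂ (AltPair-tail a≢c cd)) (AltPair-head ad))
    where a≢c = proj₁ (AltPair-tail (proj₁ ab) bc)
  ... | no z≢a =
    let z≢b , ab′ = AltPair-tail z≢a ab
        z≢d , ad′ = AltPair-tail z≢a ad
        z≢c , bc′ = AltPair-tail z≢b bc
    in skip z≢a z≢c (Alt-ac w ab′ ad′ bc′
         (proj₂ (AltPair-tail z≢b bd)) (proj₂ (AltPair-tail z≢c cd)))

first : ∀ {n} → Fin n → List (Fin n) → ℕ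
first x []       = 0
first x (z ∷ zs) with x ≟ z
... | yes _ = 0
... | no  _ = suc (first x zs)

-- An absent letter gets the length of `zs`, which no present letter gets, so it is enough that one
-- of the two occurs.
first-injective : ∀ {n} {x y : Fin n} {zs} → x ∈ zs → first x zs ≡ first y zs → x ≡ y
first-injective {x = x} {y} {z ∷ zs} x∈zs eq with x ≟ z | y ≟ z
... | yes refl | yes refl = refl
... | no  x≢z  | no  _    = first-injective (Any.tail x≢z x∈zs) (ℕₚ.suc-injective eq)

-- By `Alt y x w`, the first of the two letters to occur in `w` could only be `y`, against the order
-- of first occurrences. So `w` contains neither.
Alt-swap : ∀ {n} {x y : Fin n} w zs → first x (w ++ zs) < first y (w ++ zs) → Alt y x w → Alt x y w
Alt-swap []      zs x<y _                      = []
Alt-swap {x = x} {y} (z ∷ w) zs x<y a with x ≟ z | y ≟ z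
Alt-swap (z ∷ w) zs () _               | _        | yes _
Alt-swap (z ∷ w) zs x<y (here _)       | _        | no y≢y  = contradiction refl y≢y
Alt-swap (z ∷ w) zs x<y (skip _ z≢x _) | yes refl | _       = contradiction refl z≢x
Alt-swap (z ∷ w) zs x<y (skip z≢y z≢x a) | no _ | no _ =
  skip z≢x z≢y (Alt-swap w zs (s≤s⁻¹ x<y) a)

-- Arithmetic modulo 3

infixl 6 _⊕_

_⊕_ : Fin 3 → Fin 3 → Fin 3
a ⊕ b = (toℕ a + toℕ b) mod 3

neg : Fin 3 → Fin 3
neg a = (3 ∸ toℕ a) mod 3

neg-involutive : ∀ a → neg (neg a) ≡ a
neg-involutive = from-yes (all? λ a → neg (neg a) ≟ a)

⊕-inverseʳ : ∀ a → a ⊕ neg a ≡ 0F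
⊕-inverseʳ = from-yes (all? λ a → a ⊕ neg a ≟ 0F)

-- Cocycles modulo 3 and cliques

module _ {n} (G : Graph n) where
  open Graph G

  -- A 1-cocycle of the clique complex: every triangle of `G` counts, whether or not it bounds a
  -- face. `closed` is solved for one edge because the value there will be recovered from the other
  -- two.
  record Cocycle (h : Fin n → Fin n → Fin 3) : Set where
    field
      antisymmetric : ∀ {u v} → Adj u v → h v u ≡ neg (h u v)
      closed        : ∀ {a b c} → Adj a b → Adj b c → Adj c a → h a b ≡ neg (h b c ⊕ h c a)

  open Cocycle

  δ : (Fin n → Fin 3) → Fin n → Fin n → Fin 3
  δ f u v = f v ⊕ neg (f u)

  δ-cocycle : ∀ f → Cocycle (δ f)
  δ-cocycle f .antisymmetric {u} {v} _ =
    from-yes (all? λ a → all? λ b → a ⊕ neg b ≟ neg (b ⊕ neg a)) (f u) (f v)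
  δ-cocycle f .closed {a} {b} {c} _ _ _ =
    from-yes (all? λ a → all? λ b → all? λ c →
      b ⊕ neg a ≟ neg ((c ⊕ neg b) ⊕ (a ⊕ neg c))) (f a) (f b) (f c)

  δ-injective : ∀ {f g} {u v} → δ f u v ≡ δ g u v → f u ≡ g u → f v ≡ g v
  δ-injective {f} {g} {u} {v} = from-yes
    (all? λ a → all? λ b → all? λ c → all? λ d →
      (b ⊕ neg a ≟ d ⊕ neg c) →-dec (a ≟ c →-dec b ≟ d)) (f u) (f v) (g u) (g v)

  clique⇒K₄ : ∀ {a b c d} → Adj a b → Adj a c → Adj a d → Adj b c → Adj b d → Adj c d →
              InducedSubgraph (K 4) G
  clique⇒K₄ {a} {b} {c} {d} ab ac ad bc bd cd = f , f-injective , λ i j →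
    mk⇔ (adj i j) (λ fi~fj i≡j → adj-irrefl (subst (λ k → Adj (f i) (f k)) (sym i≡j) fi~fj))
    where
    f : Fin 4 → Fin n
    f = lookup (a ∷ b ∷ c ∷ d ∷ [])

    adj : ∀ i j → i ≢ j → Adj (f i) (f j)
    adj 0F 1F _ = ab
    adj 0F 2F _ = ac
    adj 0F 3F _ = ad
    adj 1F 2F _ = bc
    adj 1F 3F _ = bd
    adj 2F 3F _ = cd
    adj 1F 0F _ = adj-sym ab
    adj 2F 0F _ = adj-sym ac
    adj 3F 0F _ = adj-sym ad
    adj 2F 1F _ = adj-sym bc
    adj 3F 1F _ = adj-sym bd
    adj 3F 2F _ = adj-sym cd
    adj 0F 0F i≢i = contradiction refl i≢i
    adj 1F 1F i≢i = contradiction refl i≢i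
    adj 2F 2F i≢i = contradiction refl i≢i
    adj 3F 3F i≢i = contradiction refl i≢i

    f-injective : Injective _≡_ _≡_ f
    f-injective {i} {j} fi≡fj = decidable-stable (i ≟ j)
      λ i≢j → adj-irrefl (subst (Adj (f i)) (sym fi≡fj) (adj i j i≢j))

-- The cocycle of a word

module _ {n} (G : Graph n) (w : List (Fin n))
         (represents : ∀ x y → x ≢ y → Alternate x y w ⇔ Graph.Adj G x y)
         (¬K₄ : ¬ InducedSubgraph (K 4) G) where
  open Graph G
  open Cocycle

  -- The suffix makes the keys of absent letters distinct.
  key : Fin n → ℕ
  key x = first x (w ++ allFin n)

  key-injective : ∀ {x y} → key x ≡ key y → x ≡ y
  key-injective {x} = first-injective (∈-++⁺ʳ w (∈-allFin x))

  Adj⇒≢ : ∀ {x y} → Adj x y → x ≢ y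
  Adj⇒≢ xy refl = adj-irrefl xy

  Adj⇒AltPair : ∀ {x y} → Adj x y → key x < key y → AltPair x y w
  Adj⇒AltPair {x} {y} xy x<y = Adj⇒≢ xy ,
    [ id , Alt-swap w (allFin n) x<y ]′
      (Alternate⇒Alt (Adj⇒≢ xy) w (from (represents x y (Adj⇒≢ xy)) xy))

  Alt⇒Adj : ∀ {x y} → x ≢ y → Alt x y w → Adj x y
  Alt⇒Adj {x} {y} x≢y a = to (represents x y x≢y) (Alt⇒Alternate x≢y a)

  Cyclic : Fin n → Fin n → Fin n → Set
  Cyclic x y z = (key x < key y × key y < key z) ⊎
                 (key y < key z × key z < key x) ⊎
                 (key z < key x × key x < key y)

  cyclic? : ∀ x y z → Dec (Cyclic x y z)
  cyclic? x y z = (key x ℕₚ.<? key y ×-dec key y ℕₚ.<? key z) ⊎-dec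
                  (key y ℕₚ.<? key z ×-dec key z ℕₚ.<? key x) ⊎-dec
                  (key z ℕₚ.<? key x ×-dec key x ℕₚ.<? key y)

  rotate : ∀ {x y z} → Cyclic x y z → Cyclic y z x
  rotate (inj₁ p)        = inj₂ (inj₂ p)
  rotate (inj₂ (inj₁ p)) = inj₁ p
  rotate (inj₂ (inj₂ p)) = inj₂ (inj₁ p)

  cyclic-total : ∀ {x y z} → x ≢ y → y ≢ z → z ≢ x → Cyclic x y z ⊎ Cyclic y x z
  cyclic-total {x} {y} {z} x≢y y≢z z≢x
    with ℕₚ.<-cmp (key x) (key y) | ℕₚ.<-cmp (key y) (key z) | ℕₚ.<-cmp (key z) (key x)
  ... | tri≈ _ e _ | _          | _          = contradiction (key-injective e) x≢y
  ... | _          | tri≈ _ e _ | _          = contradiction (key-injective e) y≢z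
  ... | _          | _          | tri≈ _ e _ = contradiction (key-injective e) z≢x
  ... | tri< p _ _ | tri< q _ _ | _          = inj₁ (inj₁ (p , q))
  ... | tri< p _ _ | tri> _ _ q | tri< r _ _ = inj₁ (inj₂ (inj₂ (r , p)))
  ... | tri< p _ _ | tri> _ _ q | tri> _ _ r = inj₂ (inj₂ (inj₁ (r , q)))
  ... | tri> _ _ p | tri< q _ _ | tri< r _ _ = inj₁ (inj₂ (inj₁ (q , r)))
  ... | tri> _ _ p | tri< q _ _ | tri> _ _ r = inj₂ (inj₁ (p , r))
  ... | tri> _ _ p | tri> _ _ q | _          = inj₂ (inj₂ (inj₂ (q , p)))

  cyclic-asym : ∀ {x y z} → Cyclic x y z → ¬ Cyclic y x z
  cyclic-asym (inj₁ (a , b))        (inj₁ (c , d))        = ℕₚ.<-asym a c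
  cyclic-asym (inj₁ (a , b))        (inj₂ (inj₁ (c , d))) = ℕₚ.<-asym b d
  cyclic-asym (inj₁ (a , b))        (inj₂ (inj₂ (c , d))) = ℕₚ.<-asym a d
  cyclic-asym (inj₂ (inj₁ (a , b))) (inj₁ (c , d))        = ℕₚ.<-asym b d
  cyclic-asym (inj₂ (inj₁ (a , b))) (inj₂ (inj₁ (c , d))) = ℕₚ.<-asym b c
  cyclic-asym (inj₂ (inj₁ (a , b))) (inj₂ (inj₂ (c , d))) = ℕₚ.<-asym a c
  cyclic-asym (inj₂ (inj₂ (a , b))) (inj₁ (c , d))        = ℕₚ.<-asym b c
  cyclic-asym (inj₂ (inj₂ (a , b))) (inj₂ (inj₁ (c , d))) = ℕₚ.<-asym a c
  cyclic-asym (inj₂ (inj₂ (a , b))) (inj₂ (inj₂ (c , d))) = ℕₚ.<-asym b d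

  -- The two orders merge into the cyclic order u, y, v, x of the keys. The first four cases of `go`
  -- start it at each of the four letters, so that x and y come second and fourth or first and
  -- third. In the other five the hypotheses order u and v oppositely.
  opposite-adj : ∀ {u v x y} → Adj u v → Adj u x → Adj v x → Adj u y → Adj v y → x ≢ y →
                 Cyclic u v x → Cyclic v u y → Adj x y
  opposite-adj {u} {v} {x} {y} uv ux vx uy vy x≢y = go
    where
    pair = Adj⇒AltPair
    go : Cyclic u v x → Cyclic v u y → Adj x y
    go (inj₁ (a , b)) (inj₂ (inj₁ (c , d))) = adj-sym (Alt⇒Adj (≢-sym x≢y)
      (Alt-bd w (pair uy c) (pair uv a) (pair ux (ℕₚ.<-trans a b))
                (pair (adj-sym vy) d) (pair vx b)))
    go (inj₂ (inj₂ (a , b))) (inj₂ (inj₁ (c , d))) = Alt⇒Adj x≢y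
      (Alt-ac w (pair (adj-sym ux) a) (pair (adj-sym vx) (ℕₚ.<-trans a b))
                (pair uy c) (pair uv b) (pair (adj-sym vy) d))
    go (inj₂ (inj₁ (a , b))) (inj₁ (c , d)) = Alt⇒Adj x≢y
      (Alt-bd w (pair vx a) (pair (adj-sym uv) c) (pair vy (ℕₚ.<-trans c d))
                (pair (adj-sym ux) b) (pair uy d))
    go (inj₂ (inj₁ (a , b))) (inj₂ (inj₂ (c , d))) = adj-sym (Alt⇒Adj (≢-sym x≢y)
      (Alt-ac w (pair (adj-sym vy) c) (pair (adj-sym uy) (ℕₚ.<-trans c d))
                (pair vx a) (pair (adj-sym uv) d) (pair (adj-sym ux) b)))
    go (inj₁ (a , b))        (inj₁ (c , d))        = contradiction c (ℕₚ.<-asym a)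
    go (inj₁ (a , b))        (inj₂ (inj₂ (c , d))) = contradiction d (ℕₚ.<-asym a)
    go (inj₂ (inj₁ (a , b))) (inj₂ (inj₁ (c , d))) =
      contradiction (ℕₚ.<-trans c d) (ℕₚ.<-asym (ℕₚ.<-trans a b))
    go (inj₂ (inj₂ (a , b))) (inj₁ (c , d))        = contradiction c (ℕₚ.<-asym b)
    go (inj₂ (inj₂ (a , b))) (inj₂ (inj₂ (c , d))) = contradiction d (ℕₚ.<-asym b)

  Apex : Fin n → Fin n → Fin n → Set
  Apex u v x = Adj u x × Adj v x × Cyclic u v x

  apex? : ∀ u v → Dec (∃ (Apex u v))
  apex? u v = any? λ x → adj? u x ×-dec adj? v x ×-dec cyclic? u v x

  -- A common apex would make one triangle turn both ways; distinct apexes would be adjacent by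
  -- `opposite-adj` and complete a K₄.
  apex-asym : ∀ {u v} → Adj u v → ∃ (Apex u v) → ¬ ∃ (Apex v u)
  apex-asym {u} {v} uv (x , ux , vx , uvx) (y , vy , uy , vuy) with x ≟ y
  ... | yes refl = cyclic-asym uvx vuy
  ... | no x≢y   = ¬K₄ (clique⇒K₄ G uv ux uy vx vy (opposite-adj uv ux vx uy vy x≢y uvx vuy))

  -- An edge in no triangle gets an arbitrary sign.
  sign : Fin n → Fin n → Fin 3
  sign u v with apex? v u
  ... | yes _ = 2F
  ... | no  _ = 1F

  -- Reading `sign` from the smaller endpoint makes antisymmetry hold also on edges in no triangle,
  -- where `sign` is 1 in both directions.
  turn : Fin n → Fin n → Fin 3
  turn u v with u <? v
  ... | yes _ = sign u v
  ... | no  _ = neg (sign v u)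

  turn-nonzero : ∀ u v → turn u v ≢ 0F
  turn-nonzero u v with u <? v
  turn-nonzero u v | yes _ with apex? v u
  ... | yes _ = λ ()
  ... | no  _ = λ ()
  turn-nonzero u v | no  _ with apex? u v
  ... | yes _ = λ ()
  ... | no  _ = λ ()

  turn-antisymmetric : ∀ {u v} → Adj u v → turn v u ≡ neg (turn u v)
  turn-antisymmetric {u} {v} uv with u <? v | v <? u
  ... | yes p | yes q = contradiction q (ℕₚ.<-asym p)
  ... | yes p | no  q = refl
  ... | no  p | yes q = sym (neg-involutive _)
  ... | no  p | no  q with <-cmp u v
  ... | tri< r _ _    = contradiction r p
  ... | tri≈ _ e _    = contradiction e (Adj⇒≢ uv)
  ... | tri> _ _ r    = contradiction r q

  turn≡1 : ∀ {u v} → Adj u v → ∃ (Apex u v) → turn u v ≡ 1F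
  turn≡1 {u} {v} uv ax with u <? v
  turn≡1 {u} {v} uv ax | yes _ with apex? v u
  ... | yes ax′ = contradiction ax′ (apex-asym uv ax)
  ... | no  _   = refl
  turn≡1 {u} {v} uv ax | no _ with apex? u v
  ... | yes _   = refl
  ... | no ¬ax  = contradiction ax ¬ax

  turn≡2 : ∀ {u v} → Adj u v → ∃ (Apex v u) → turn u v ≡ 2F
  turn≡2 {u} {v} uv ax = trans (turn-antisymmetric (adj-sym uv)) (cong neg (turn≡1 (adj-sym uv) ax))

  -- The three edges of a triangle turn the same way, and both 1 + 1 + 1 and 2 + 2 + 2 vanish modulo
  -- 3.
  turn-cocycle : Cocycle G turn
  turn-cocycle .antisymmetric = turn-antisymmetric
  turn-cocycle .closed {a} {b} {c} ab bc ca
    with cyclic-total {a} {b} {c} (Adj⇒≢ ab) (Adj⇒≢ bc) (Adj⇒≢ ca)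
  ... | inj₁ abc
    rewrite turn≡1 ab (c , adj-sym ca , bc , abc)
          | turn≡1 bc (a , adj-sym ab , ca , rotate abc)
          | turn≡1 ca (b , adj-sym bc , ab , rotate (rotate abc)) = refl
  ... | inj₂ bac
    rewrite turn≡2 ab (c , bc , adj-sym ca , bac)
          | turn≡2 bc (a , ca , adj-sym ab , rotate (rotate bac))
          | turn≡2 ca (b , ab , adj-sym bc , rotate bac) = refl

-- Cocycles of a near-triangulation

-- A missed value could be punched out of the codomain, leaving it smaller than the domain.
injective⇒surjective : ∀ {m k} {f : Fin m → Fin k} → k ≤ m →
  Injective _≡_ _≡_ f → ∀ y → ∃[ x ] f x ≡ y
injective⇒surjective {m} {suc k} {f} k<m f-injective y =
  decidable-stable (any? λ x → f x ≟ y) λ ∄x →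
    let y≢f = λ x y≡fx → ∄x (x , sym y≡fx) in
    ℕₚ.<⇒≱ k<m (injective⇒≤ (λ {x} {x′} eq → f-injective (punchOut-injective (y≢f x) (y≢f x′) eq)))

funToFin-cong : ∀ {m k} {f g : Fin m → Fin k} → f ≗ g → funToFin f ≡ funToFin g
funToFin-cong {zero}  f≗g = refl
funToFin-cong {suc m} f≗g = cong₂ combine (f≗g zero) (funToFin-cong (f≗g ∘ suc))

-- The pigeonhole principle on the codes `funToFin`, which number functions up to pointwise
-- equality. The base `suc k` is positive, so the number of functions is monotone in the size of the
-- domain.
≗-injective⇒surjective : ∀ {k m l} (F : (Fin m → Fin (suc k)) → Fin l → Fin (suc k)) → l ≤ m →
  (∀ {f g} → F f ≗ F g → f ≗ g) → ∀ g → ∃[ f ] F f ≗ g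
≗-injective⇒surjective {k} {m} {l} F l≤m F-injective g =
  let x , eq = injective⇒surjective (ℕₚ.^-monoʳ-≤ (suc k) l≤m) code-injective (funToFin g)
  in finToFun x , decode eq
  where
  code : Fin (suc k ^ m) → Fin (suc k ^ l)
  code x = funToFin (F (finToFun x))

  decode : ∀ {f g : Fin l → Fin (suc k)} → funToFin f ≡ funToFin g → f ≗ g
  decode {f} {g} eq i = begin
    f i                       ≡⟨ finToFun-funToFin f i ⟨
    finToFun (funToFin f) i   ≡⟨ cong (λ x → finToFun x i) eq ⟩
    finToFun (funToFin g) i   ≡⟨ finToFun-funToFin g i ⟩
    g i                       ∎
    where open ≡-Reasoning

  code-injective : Injective _≡_ _≡_ code
  code-injective {x} {y} eq = begin
    x                          ≡⟨ funToFin-finToFin {m} {suc k} x ⟨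
    funToFin {m} (finToFun {suc k} x)  ≡⟨ funToFin-cong (F-injective (decode eq)) ⟩
    funToFin {m} (finToFun {suc k} y)  ≡⟨ funToFin-finToFin {m} {suc k} y ⟩
    y                          ∎
    where open ≡-Reasoning

unsplit : ∀ {a} {A : Set a} {C l} {p q : Fin C ⊎ Fin l → A} →
  p ∘ splitAt C ≗ q ∘ splitAt C → p ≗ q
unsplit {C = C} {l} {p} {q} eq x = subst (λ x → p x ≡ q x) (splitAt-join C l x) (eq (join C l x))

∈-─ : ∀ {a} {A : Set a} {x y : A} {xs} (p : y ∈ xs) → x ∈ xs → x ≡ y ⊎ x ∈ (xs ─ p)
∈-─ (here refl) (here refl) = inj₁ refl
∈-─ (here refl) (there q)   = inj₂ q
∈-─ (there p)   (here refl) = inj₂ (here refl)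
∈-─ (there p)   (there q)   with ∈-─ p q
... | inj₁ x≡y = inj₁ x≡y
... | inj₂ r   = inj₂ (there r)

covering⇒≤length : ∀ {m} (xs : List (Fin m)) → (∀ i → i ∈ xs) → m ≤ length xs
covering⇒≤length xs cover = injective⇒≤ {f = index ∘ cover} λ {i} {j} eq → begin
  i                            ≡⟨ lookup-index (cover i) ⟩
  lookup xs (index (cover i))  ≡⟨ cong (lookup xs) eq ⟩
  lookup xs (index (cover j))  ≡⟨ lookup-index (cover j) ⟨
  j                            ∎
  where open ≡-Reasoning

-- Exploring the faces through the dual graph

module _ {n} {G : Graph n} (P : PlaneEmbedding G) (triangulated : IsNearTriangulation P) where
  open Graph G
  open PlaneEmbedding P
  open Cocycle
  open DecMembership (_≟_ {#faces}) using (_∈?_)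

  -- Walking around v, face v (next v u) is the face on the other side of the
  -- edge from v to u.
  across-closed⇒all : ∀ (Q : Fin #faces → Set) → Q outer →
    (∀ {u v} → Adj u v → Q (face v u) → Q (face u v)) → ∀ f → Q f
  across-closed⇒all Q Q-outer across f = along (connected (inj₂ outer) (inj₂ f)) Q-outer
    where
    around : ∀ {v u} k → Adj v u → Q (face v u) → Q (face v (iterate (next v) u k))
    around zero    vu q = q
    around (suc k) vu q =
      around k (next-adj vu) (subst Q (face-walk (adj-sym vu)) (across (adj-sym vu) q))

    incident : ∀ {v f g} → Incident v f → Incident v g → Q f → Q g
    incident (corner vu) (corner vw) q with k , refl ← next-cyclic vu vw = around k vu q
    incident (corner vu) (lone iso)  q = contradiction vu (iso _)
    incident (lone iso)  (corner vu) q = contradiction vu (iso _)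
    incident (lone _)    (lone _)    q = q

    -- The property carried along a path of vertices and faces; on passing from a face to a vertex,
    -- `incident` spreads `Q` to all faces there.
    Holds : Fin n ⊎ Fin #faces → Set
    Holds (inj₁ v) = ∀ {f} → Incident v f → Q f
    Holds (inj₂ f) = Q f

    along : ∀ {s t} → EqClosure Touch s t → Holds s → Holds t
    along ε                    q = q
    along (fwd (touch i) ◅ st) q = along st (q i)
    along (bwd (touch i) ◅ st) q = along st (λ j → incident i j q)

  Crossing : List (Fin #faces) → Set
  Crossing Q = ∃₂ λ u v → Adj u v × face u v ∉ Q × face v u ∈ Q

  crossing? : ∀ Q → Dec (Crossing Q)
  crossing? Q = any? λ u → any? λ v → adj? u v ×-dec ¬? (face u v ∈? Q) ×-dec face v u ∈? Q

  ¬crossing⇒all : ∀ {Q} → outer ∈ Q → ¬ Crossing Q → ∀ f → f ∈ Q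
  ¬crossing⇒all {Q} outer∈Q ¬crossing = across-closed⇒all (_∈ Q) outer∈Q λ {u} {v} uv vu∈Q →
    decidable-stable (face u v ∈? Q) λ uv∉Q → ¬crossing (u , v , uv , uv∉Q , vu∈Q)

  triangle-at : ∀ {u v} → Adj u v → face u v ≢ outer →
    ∃[ w ] Adj v w × Adj w u × face v w ≡ face u v × face w u ≡ face u v
  triangle-at {u} {v} uv ≢outer
    with a , b , c , ab , bc , ca , darts , _ ← triangulated (face u v) ≢outer
    with to (darts u v uv) refl
  ... | here refl                 =
    c , bc , ca ,
    from (darts _ _ bc) (there (here refl)) , from (darts _ _ ca) (there (there (here refl)))
  ... | there (here refl)         =
    a , ca , ab , from (darts _ _ ca) (there (there (here refl))) , from (darts _ _ ab) (here refl)
  ... | there (there (here refl)) =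
    b , ab , bc , from (darts _ _ ab) (here refl) , from (darts _ _ bc) (there (here refl))

  Determining : List (Fin n × Fin n) → Set
  Determining S = ∀ {h h′} → Cocycle G h → Cocycle G h′ → (∀ {u v} → (u , v) ∈ S → h u v ≡ h′ u v) →
                  ∀ {u v} → Adj u v → h u v ≡ h′ u v

  agree-sym : ∀ {h h′} → Cocycle G h → Cocycle G h′ →
    ∀ {u v} → Adj u v → h u v ≡ h′ u v → h v u ≡ h′ v u
  agree-sym H H′ uv eq =
    trans (antisymmetric H uv) (trans (cong neg eq) (sym (antisymmetric H′ uv)))

  -- Q is the set of faces reached by a growing tree in the dual graph, and S
  -- the set of edges that this tree does not cross.
  record Exploration (S : List (Fin n × Fin n)) (Q : List (Fin #faces)) : Set where
    field
      outer∈Q     : outer ∈ Q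
      count       : length S + length Q ≡ 1 + #edges
      uncrossed   : ∀ {u v} → Adj u v → ((u , v) ∈ S ⊎ (v , u) ∈ S) ⊎ (face u v ∈ Q × face v u ∈ Q)
      determining : Determining S

  open Exploration

  start : ∃[ S ] Exploration S [ outer ]
  start = edges , record
    { outer∈Q     = here refl
    ; count       = ℕₚ.+-comm #edges 1
    ; uncrossed   = inj₁ ∘ listed
    ; determining = λ H H′ agree uv →
        [ agree , agree-sym H H′ (adj-sym uv) ∘ agree ]′ (listed uv)
    }
    where
    -- The same list as in the definition of `#edges`, each edge being listed once with its smaller
    -- end first. Hence `count` is mere commutativity.
    edges = filter (λ (u , v) → (u <? v) ×-dec adj? u v) (cartesianProduct (allFin n) (allFin n))

    listed : ∀ {u v} → Adj u v → (u , v) ∈ edges ⊎ (v , u) ∈ edges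
    listed {u} {v} uv with <-cmp u v
    ... | tri< u<v _ _  = inj₁
      (∈-filter⁺ _ (∈-cartesianProduct⁺ (∈-allFin u) (∈-allFin v)) (u<v , uv))
    ... | tri≈ _ refl _ = contradiction uv adj-irrefl
    ... | tri> _ _ v<u  = inj₂
      (∈-filter⁺ _ (∈-cartesianProduct⁺ (∈-allFin v) (∈-allFin u)) (v<u , adj-sym uv))

  -- The new face is a triangle whose other two edges are uncrossed, so a
  -- cocycle is determined on the newly crossed edge by closedness.
  extend : ∀ {S Q u v} → Exploration S Q → Adj u v → face u v ∉ Q → face v u ∈ Q →
    ∀ {p q} (e∈S : (p , q) ∈ S) → (p , q) ≡ (u , v) ⊎ (p , q) ≡ (v , u) →
    Exploration (S ─ e∈S) (face u v ∷ Q)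
  extend {S} {Q} {u} {v} X uv uv∉Q vu∈Q {p} {q} e∈S e≡ = record
    { outer∈Q     = there (outer∈Q X)
    -- One edge leaves `S` as one face enters `Q`, so the sum is unchanged.
    ; count       = trans (ℕₚ.+-suc _ _)
        (trans (cong (_+ length Q) (sym (length-removeAt′ S (index e∈S)))) (count X))
    ; uncrossed   = uncrossed′
    ; determining = determining′
    }
    where
    S′ = S ─ e∈S

    kept : ∀ {x y} → Adj x y → ((x , y) ≡ (u , v) ⊎ (x , y) ≡ (v , u)) ⊎
           ((x , y) ∈ S′ ⊎ (y , x) ∈ S′) ⊎ (face x y ∈ Q × face y x ∈ Q)
    kept xy with uncrossed X xy
    ... | inj₂ both = inj₂ (inj₂ both)
    ... | inj₁ (inj₁ xy∈S) with ∈-─ e∈S xy∈S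
    ...   | inj₂ xy∈S′ = inj₂ (inj₁ (inj₁ xy∈S′))
    ...   | inj₁ refl  = inj₁ e≡
    kept xy | inj₁ (inj₂ yx∈S) with ∈-─ e∈S yx∈S
    ...   | inj₂ yx∈S′ = inj₂ (inj₁ (inj₂ yx∈S′))
    ...   | inj₁ refl  = inj₁ ([ (λ { refl → inj₂ refl }) , (λ { refl → inj₁ refl }) ]′ e≡)

    uncrossed′ : ∀ {x y} → Adj x y →
      ((x , y) ∈ S′ ⊎ (y , x) ∈ S′) ⊎ (face x y ∈ face u v ∷ Q × face y x ∈ face u v ∷ Q)
    uncrossed′ xy with kept xy
    ... | inj₁ (inj₁ refl)        = inj₂ (here refl , there vu∈Q)
    ... | inj₁ (inj₂ refl)        = inj₂ (there vu∈Q , here refl)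
    ... | inj₂ (inj₁ listed)      = inj₁ listed
    ... | inj₂ (inj₂ (xy∈ , yx∈)) = inj₂ (there xy∈ , there yx∈)

    determining′ : Determining S′
    determining′ {h} {h′} H H′ agree = determining X H H′ agree-S
      where
      agree-new : ∀ {x y} → Adj x y → face x y ≡ face u v →
        (x , y) ≢ (u , v) → (x , y) ≢ (v , u) → h x y ≡ h′ x y
      agree-new xy same ≢uv ≢vu with kept xy
      ... | inj₁ (inj₁ ≡uv)          = contradiction ≡uv ≢uv
      ... | inj₁ (inj₂ ≡vu)          = contradiction ≡vu ≢vu
      ... | inj₂ (inj₁ (inj₁ xy∈S′)) = agree xy∈S′
      ... | inj₂ (inj₁ (inj₂ yx∈S′)) = agree-sym H H′ (adj-sym xy) (agree yx∈S′)
      -- A crossed edge has both its faces in `Q`, but this one borders the new face.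
      ... | inj₂ (inj₂ (xy∈Q , _))   = contradiction (subst (_∈ Q) same xy∈Q) uv∉Q

      agree-uv : h u v ≡ h′ u v
      -- The new face is not the outer one, which is already in `Q`, so it is a triangle.
      agree-uv with w , vw , wu , same-vw , same-wu ←
        triangle-at uv (λ eq → uv∉Q (subst (_∈ Q) (sym eq) (outer∈Q X))) = begin
        h u v                  ≡⟨ closed H uv vw wu ⟩
        neg (h v w ⊕ h w u)    ≡⟨ cong₂ (λ a b → neg (a ⊕ b)) vw-agrees wu-agrees ⟩
        neg (h′ v w ⊕ h′ w u)  ≡⟨ closed H′ uv vw wu ⟨
        h′ u v                 ∎
        where
        open ≡-Reasoning
        -- As `G` has no loops, neither of the other two edges is the crossed edge in either
        -- direction.
        vw-agrees = agree-new vw same-vw (λ { refl → adj-irrefl uv }) (λ { refl → adj-irrefl wu })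
        wu-agrees = agree-new wu same-wu (λ { refl → adj-irrefl uv }) (λ { refl → adj-irrefl vw })

      agree-S : ∀ {x y} → (x , y) ∈ S → h x y ≡ h′ x y
      agree-S xy∈S with ∈-─ e∈S xy∈S
      ... | inj₂ xy∈S′ = agree xy∈S′
      ... | inj₁ refl  = [ (λ { refl → agree-uv }) , (λ { refl → agree-sym H H′ uv agree-uv }) ]′ e≡

  uncrossed-edge : ∀ {S Q u v} → Exploration S Q → Adj u v → face u v ∉ Q →
    ∃[ e ] e ∈ S × (e ≡ (u , v) ⊎ e ≡ (v , u))
  uncrossed-edge X uv uv∉Q with uncrossed X uv
  ... | inj₁ (inj₁ uv∈S) = _ , uv∈S , inj₁ refl
  ... | inj₁ (inj₂ vu∈S) = _ , vu∈S , inj₂ refl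
  ... | inj₂ (uv∈Q , _)  = contradiction uv∈Q uv∉Q

  -- Recursion on the length of `S`: a crossing edge still belongs to `S`, and crossing it removes
  -- it.
  explore : ∀ m {S Q} → length S ≡ m → Exploration S Q → ∃₂ λ S Q → Exploration S Q × (∀ f → f ∈ Q)
  explore m {S} {Q} eq X with crossing? Q
  ... | no ¬crossing = S , Q , X , ¬crossing⇒all (outer∈Q X) ¬crossing
  ... | yes (u , v , uv , uv∉Q , vu∈Q) with uncrossed-edge X uv uv∉Q
  explore zero    {_ ∷ _} () X | yes _ | _ , _ , _
  explore (suc m) {S} eq X | yes (u , v , uv , uv∉Q , vu∈Q) | _ , e∈S , e≡ =
    explore m (ℕₚ.suc-injective (trans (sym (length-removeAt′ S (index e∈S))) eq))
      (extend X uv uv∉Q vu∈Q e∈S e≡)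

  -- As `Q` covers all faces, `count` leaves at most 1 + E - F edges in `S`. By Euler's formula this
  -- is n minus the number of components, the size of a spanning forest.
  determining-set : ∃[ S ] #components + length S ≤ n × Determining S
  determining-set with S , Q , X , all ← explore _ refl (proj₂ start) =
    S , ℕₚ.+-cancelʳ-≤ #faces _ _ bound , determining X
    where
    open ℕₚ.≤-Reasoning
    bound : #components + length S + #faces ≤ n + #faces
    bound = begin
      #components + length S + #faces    ≡⟨ ℕₚ.+-assoc #components _ _ ⟩
      #components + (length S + #faces)
        ≤⟨ ℕₚ.+-monoʳ-≤ #components (ℕₚ.+-monoʳ-≤ (length S) (covering⇒≤length Q all)) ⟩
      #components + (length S + length Q) ≡⟨ cong (#components +_) (count X) ⟩
      #components + (1 + #edges)         ≡⟨ ℕₚ.+-suc #components #edges ⟩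
      1 + #components + #edges           ≡⟨ euler ⟨
      n + #faces                         ∎

  -- Potentials by counting

  rep : Fin #components → Fin n
  rep i = proj₁ (proj₁ (proj₂ components) i)

  rep-path : ∀ u → Star Adj (rep (proj₁ components u)) u
  rep-path u with comp , surjective , paths ← components =
    to (paths _ u) (proj₂ (surjective (comp u)))

  Index : List (Fin n × Fin n) → Set
  Index S = Fin #components ⊎ Fin (length S)

  values : ∀ S → (Fin n → Fin 3) → Index S → Fin 3
  values S f = [ f ∘ rep , uncurry (δ G f) ∘ lookup S ]′

  -- A determining set fixes the coboundary on every edge, and the values then spread from the
  -- representatives along paths.
  values-injective : ∀ {S} → Determining S → ∀ {f g} → values S f ≗ values S g → f ≗ g
  values-injective {S} determines {f} {g} eq u = along (rep-path u) (eq (inj₁ _))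
    where
    δf≡δg : ∀ {u v} → (u , v) ∈ S → δ G f u v ≡ δ G g u v
    δf≡δg uv∈S = subst (λ (u , v) → δ G f u v ≡ δ G g u v)
      (sym (lookup-index uv∈S)) (eq (inj₂ (index uv∈S)))

    along : ∀ {u v} → Star Adj u v → f u ≡ g u → f v ≡ g v
    along ε         e = e
    along (uw ◅ wv) e = along wv
      (δ-injective G {f} {g} (determines (δ-cocycle G f) (δ-cocycle G g) δf≡δg uw) e)

  -- `values S` is injective on the 3-valued functions on n points, and its target consists of such
  -- functions on at most n points.
  values-surjective : ∀ {S} → #components + length S ≤ n → Determining S →
    ∀ p → ∃[ f ] values S f ≗ p
  values-surjective {S} bound determines p =
    let f , eq = ≗-injective⇒surjective {2} (λ f → values S f ∘ splitAt #components) bound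
          (λ {f} {g} eq → values-injective determines (unsplit {p = values S f} {values S g} eq))
          (p ∘ splitAt #components)
    in f , unsplit {p = values S f} {p} eq

  -- The vanishing of the first cohomology group.  A potential f is sought with
  -- prescribed values of f at one vertex per component and of δ f on a
  -- determining set; these are at most n values, and they determine f.
  potential : ∀ {h} → Cocycle G h → ∃[ f ] ∀ {u v} → Adj u v → δ G f u v ≡ h u v
  potential {h} H
    with S , bound , determines ← determining-set
    with f , f-values ← values-surjective {S} bound determines
      -- The values at the representatives may be chosen freely; they are set to 0.
      [ (λ _ → 0F) , uncurry h ∘ lookup S ]′ =
    f , determines (δ-cocycle G f) H λ uv∈S →
      subst (λ (u , v) → δ G f u v ≡ h u v) (sym (lookup-index uv∈S)) (f-values (inj₂ (index uv∈S)))

  nonzero-cocycle⇒3-colourable : ∀ {h} → Cocycle G h → (∀ u v → h u v ≢ 0F) → Colourable 3 G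
  nonzero-cocycle⇒3-colourable {h} H nonzero =
    let f , δf≡h = potential H in
    f , λ u v uv fu≡fv → nonzero u v (begin
      h u v            ≡⟨ δf≡h uv ⟨
      f v ⊕ neg (f u)  ≡⟨ cong (λ a → f v ⊕ neg a) fu≡fv ⟩
      f v ⊕ neg (f v)  ≡⟨ ⊕-inverseʳ (f v) ⟩
      0F               ∎)
    where open ≡-Reasoning

word-representable⇒3-colourable : ∀ {n} {G : Graph n} (P : PlaneEmbedding G) →
  IsNearTriangulation P → ¬ InducedSubgraph (K 4) G → WordRepresentable G → Colourable 3 G
word-representable⇒3-colourable {G = G} P triangulated ¬K₄ (w , represents) =
  nonzero-cocycle⇒3-colourable P triangulated
    (turn-cocycle G w represents ¬K₄) (turn-nonzero G w represents ¬K₄)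

-- The word of a 3-colouring

Linked-++⁻ : ∀ {a ℓ} {A : Set a} {R : A → A → Set ℓ} xs {ys} →
  Linked R (xs ++ ys) → Linked R xs × Linked R ys
Linked-++⁻ []           l       = [] , l
Linked-++⁻ (x ∷ [])     l       = [-] , tail l
Linked-++⁻ (x ∷ y ∷ xs) (r ∷ l) with l₁ , l₂ ← Linked-++⁻ (y ∷ xs) l = r ∷ l₁ , l₂

filter-singleton : ∀ {a p} {A : Set a} {P : Pred A p} (P? : Decidable₁ P) {x xs} →
  Unique xs → x ∈ xs → P x → (∀ {z} → z ∈ xs → P z → z ≡ x) → filter P? xs ≡ x ∷ []
filter-singleton P? {x} (x≢ ∷ _) (here refl) px only =
  trans (filter-accept P? px)
    (cong (x ∷_) (filter-none P?
      (All.tabulate λ z∈ pz → All.lookup x≢ z∈ (sym (only (there z∈) pz)))))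
filter-singleton P? (z≢ ∷ uniq) (there x∈) px only =
  trans (filter-reject P? (λ pz → All.lookup z≢ x∈ (only (here refl) pz)))
    (filter-singleton P? uniq x∈ px (only ∘ there))

Alternate-sym : ∀ {n} {x y : Fin n} w → Alternate x y w → Alternate y x w
Alternate-sym {x = x} {y} w = subst (Linked _≢_)
  (filter-≐ (λ z → (z ≟ x) ⊎-dec (z ≟ y)) (λ z → (z ≟ y) ⊎-dec (z ≟ x)) (swap , swap) w)

-- Expanding words of types into words of vertices

module _ {n} {T : Set} (_≟ₜ_ : DecidableEquality T) (τ : Fin n → T) where

  fibre : T → List (Fin n)
  fibre t = filter (λ z → τ z ≟ₜ t) (allFin n)

  fibre-sound : ∀ {z t} → z ∈ fibre t → τ z ≡ t
  fibre-sound {t = t} = proj₂ ∘ ∈-filter⁻ (λ z → τ z ≟ₜ t) {xs = allFin n}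

  fibre-singleton : ∀ {p} {P : Pred (Fin n) p} (P? : Decidable₁ P) {z} → P z →
    (∀ {z′} → τ z′ ≡ τ z → P z′ → z′ ≡ z) → filter P? (fibre (τ z)) ≡ z ∷ []
  fibre-singleton P? {z} pz only = filter-singleton P?
    (Unique.filter⁺ (λ z′ → τ z′ ≟ₜ τ z) (Unique.allFin⁺ n))
    (∈-filter⁺ (λ z′ → τ z′ ≟ₜ τ z) (∈-allFin z) refl) pz (only ∘ fibre-sound)

  expand : List T → List (Fin n)
  expand = concatMap fibre

  -- A fibre lists each of its vertices once. So the fibre of `τ x` contributes just `x`, that of
  -- `τ y` just `y`, and every other fibre nothing.
  project-expand : ∀ {x y} → τ x ≢ τ y → ∀ ts →
    project _≟_ x y (expand ts) ≡
    map (λ t → if does (t ≟ₜ τ x) then x else y) (project _≟ₜ_ (τ x) (τ y) ts)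
  project-expand {x} {y} τx≢τy [] = refl
  project-expand {x} {y} τx≢τy (t ∷ ts)
    rewrite filter-++ (λ z → (z ≟ x) ⊎-dec (z ≟ y)) (fibre t) (expand ts)
          | project-expand τx≢τy ts
    with t ≟ₜ τ x in eq | t ≟ₜ τ y
  ... | yes refl | yes τx≡τy = contradiction τx≡τy τx≢τy
  ... | yes refl | no  _
    rewrite eq | fibre-singleton (λ z → (z ≟ x) ⊎-dec (z ≟ y)) {x} (inj₁ refl)
      (λ τz≡τx → [ id , (λ { refl → contradiction (sym τz≡τx) τx≢τy }) ]′) = refl
  ... | no t≢τx  | yes refl
    rewrite eq | fibre-singleton (λ z → (z ≟ x) ⊎-dec (z ≟ y)) {y} (inj₂ refl)
      (λ τz≡τy → [ (λ { refl → contradiction τz≡τy τx≢τy }) , id ]′) = refl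
  ... | no t≢τx  | no t≢τy
    rewrite filter-none (λ z → (z ≟ x) ⊎-dec (z ≟ y)) {fibre t} (All.tabulate λ z∈ →
      [ (λ { refl → t≢τx (sym (fibre-sound z∈)) })
      , (λ { refl → t≢τy (sym (fibre-sound z∈)) }) ]′) = refl

-- The type of a vertex relative to a fixed vertex v: nothing for v itself,
-- otherwise its colour and whether it is adjacent to v.
Type : Set
Type = Maybe (Fin 3 × Bool)

_≟ₜ_ : DecidableEquality Type
_≟ₜ_ = Maybe.≡-dec (Product.≡-dec _≟_ Bool._≟_)

self : List Type
self = nothing ∷ []

non nbr every : Fin 3 → List Type
non i   = just (i , false) ∷ []
nbr i   = just (i , true) ∷ []
every i = non i ++ nbr i

-- Apart from `self`, each schedule runs twice through the types in order of colour, so types of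
-- different colours interleave. The two letters `self` interleave with the neighbours of the other
-- two colours. In `schedule 0F` and `schedule 2F` they fail to alternate with any nonadjacent type;
-- in `schedule 1F` they interleave with everything of colours 0 and 2 and fail only against colour
-- 1.
schedule : Fin 3 → List Type
schedule 0F = every 0F ++ non 1F ++ self ++ nbr 1F ++ nbr 2F ++ self ++ non 2F ++
              every 0F ++ every 1F ++ every 2F
schedule 1F = every 0F ++ self ++ every 1F ++ every 2F ++
              every 0F ++ every 1F ++ self ++ every 2F
schedule 2F = every 0F ++ every 1F ++ every 2F ++
              non 0F ++ self ++ nbr 0F ++ nbr 1F ++ self ++ non 1F ++ every 2F

Interleaved : Fin 3 → Type → Type → Set
Interleaved i s t = project _≟ₜ_ s t (schedule i) ≡ s ∷ t ∷ s ∷ t ∷ []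

interleaved? : ∀ i s t → Dec (Interleaved i s t)
interleaved? i s t = ≡-dec _≟ₜ_ _ _

∀Bool? : ∀ {p} {P : Bool → Set p} → (∀ b → Dec (P b)) → Dec (∀ b → P b)
∀Bool? P? with P? false | P? true
... | yes p | yes q = yes λ { false → p ; true → q }
... | no ¬p | _     = no λ f → ¬p (f false)
... | _     | no ¬q = no λ f → ¬q (f true)

-- Checked over all cases; neither vertex is v, so their adjacencies to v are arbitrary.
other-other : ∀ i j b k b′ → j Fin.< k → Interleaved i (just (j , b)) (just (k , b′))
other-other = from-yes (all? λ i → all? λ j → ∀Bool? λ b → all? λ k → ∀Bool? λ b′ →
  j <? k →-dec interleaved? i (just (j , b)) (just (k , b′)))

self-other : ∀ i k → i Fin.< k → Interleaved i nothing (just (k , true))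
self-other = from-yes (all? λ i → all? λ k → i <? k →-dec interleaved? i nothing (just (k , true)))

other-self : ∀ i j → j Fin.< i → Interleaved i (just (j , true)) nothing
other-self = from-yes (all? λ i → all? λ j → j <? i →-dec interleaved? i (just (j , true)) nothing)

self-nonadjacent : ∀ i k → i ≢ 1F ⊎ k ≡ 1F →
  ¬ Linked _≢_ (project _≟ₜ_ nothing (just (k , false)) (schedule i))
self-nonadjacent = from-yes (all? λ i → all? λ k → (¬? (i ≟ 1F) ⊎-dec k ≟ 1F) →-dec
  ¬? (linked? (λ s t → ¬? (s ≟ₜ t)) (project _≟ₜ_ nothing (just (k , false)) (schedule i))))

-- Blocks and the representing word

module _ {n} (G : Graph n) (c : Fin n → Fin 3) (proper : ∀ u v → Graph.Adj G u v → c u ≢ c v) where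
  open Graph G

  type : Fin n → Fin n → Type
  type v x with x ≟ v
  ... | yes _ = nothing
  ... | no  _ = just (c x , does (adj? v x))

  type-self : ∀ v → type v v ≡ nothing
  type-self v with v ≟ v
  ... | yes _   = refl
  ... | no  v≢v = contradiction refl v≢v

  type-nonadjacent : ∀ {v x} → x ≢ v → ¬ Adj v x → type v x ≡ just (c x , false)
  type-nonadjacent {v} {x} x≢v v≁x with x ≟ v
  ... | yes x≡v = contradiction x≡v x≢v
  ... | no  _   = cong (λ b → just (c x , b)) (dec-false (adj? v x) v≁x)

  block : Fin n → List (Fin n)
  block v = expand _≟ₜ_ (type v) (schedule (c v))

  word : List (Fin n)
  word = concatMap block (allFin n)

  edge-interleaved : ∀ {x y} → Adj x y → c x Fin.< c y → ∀ v →
    Interleaved (c v) (type v x) (type v y)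
  edge-interleaved {x} {y} xy x<y v with x ≟ v | y ≟ v
  ... | yes refl | yes refl = contradiction xy adj-irrefl
  ... | no  _    | no  _    = other-other (c v) (c x) _ (c y) _ x<y
  ... | yes refl | no  _    with adj? x y
  ...   | yes _  = self-other (c x) (c y) x<y
  ...   | no x≁y = contradiction xy x≁y
  edge-interleaved {x} {y} xy x<y v | no _ | yes refl with adj? y x
  ...   | yes _  = other-self (c y) (c x) x<y
  ...   | no y≁x = contradiction (adj-sym xy) y≁x

  type-colour : ∀ v {x y} → type v x ≡ type v y → c x ≡ c y
  type-colour v {x} {y} eq with x ≟ v | y ≟ v
  type-colour v refl | yes refl | yes refl = refl
  type-colour v eq   | no  _    | no  _    = cong proj₁ (Maybe.just-injective eq)

  project-block : ∀ {x y} → Adj x y → c x Fin.< c y → ∀ v →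
    project _≟_ x y (block v) ≡ x ∷ y ∷ x ∷ y ∷ []
  project-block {x} {y} xy x<y v
    rewrite project-expand _≟ₜ_ (type v) {x} {y} (proper x y xy ∘ type-colour v) (schedule (c v))
          | edge-interleaved xy x<y v
          | dec-true (type v x ≟ₜ type v x) refl
          | dec-false (type v y ≟ₜ type v x) (proper x y xy ∘ sym ∘ type-colour v) = refl

  adjacent-alternate : ∀ {x y} → Adj x y → c x Fin.< c y → Alternate x y word
  adjacent-alternate {x} {y} xy x<y = tail (linked (allFin n))
    where
    x≢y = λ x≡y → proper x y xy (cong c x≡y)

    -- The prefixed `y` is the end of the preceding block, since every block projects to xyxy.
    linked : ∀ vs → Linked _≢_ (y ∷ project _≟_ x y (concatMap block vs))
    linked []       = [-]
    linked (v ∷ vs)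
      rewrite filter-++ (λ z → (z ≟ x) ⊎-dec (z ≟ y)) (block v) (concatMap block vs)
            | project-block xy x<y v = ≢-sym x≢y ∷ x≢y ∷ ≢-sym x≢y ∷ x≢y ∷ linked vs

  alternate-block : ∀ {x y v} vs → v ∈ vs →
    Alternate x y (concatMap block vs) → Alternate x y (block v)
  alternate-block {x} {y} (v ∷ vs) v∈ l
    rewrite filter-++ (λ z → (z ≟ x) ⊎-dec (z ≟ y)) (block v) (concatMap block vs)
    with v∈ | Linked-++⁻ (project _≟_ x y (block v)) l
  ... | here refl | l₁ , _  = l₁
  ... | there v∈vs | _ , l₂ = alternate-block vs v∈vs l₂

  nonadjacent-¬alternate : ∀ {x y} → x ≢ y → ¬ Adj x y → c x ≢ 1F ⊎ c y ≡ 1F → ¬ Alternate x y word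
  nonadjacent-¬alternate {x} {y} x≢y x≁y colours l = self-nonadjacent (c x) (c y) colours
    (subst₂ (λ s t → Linked _≢_ (project _≟ₜ_ s t (schedule (c x)))) τx τy
      -- Letters that differ after the renaming in `project-expand` come from different types, so
      -- alternation passes back to the schedule.
      (Linked.map (λ fs≢ft s≡t → fs≢ft (cong _ s≡t)) (Linkedₚ.map⁻
        (subst (Linked _≢_) (project-expand _≟ₜ_ (type x) τx≢τy (schedule (c x)))
          (alternate-block (allFin n) (∈-allFin x) l)))))
    where
    τx = type-self x
    τy = type-nonadjacent (≢-sym x≢y) x≁y

    τx≢τy : type x x ≢ type x y
    τx≢τy eq with () ← trans (sym τx) (trans eq τy)

3-colourable⇒word-representable : ∀ {n} {G : Graph n} → Colourable 3 G → WordRepresentable G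
3-colourable⇒word-representable {G = G} (c , proper) = w , λ x y x≢y →
  mk⇔ (λ l → decidable-stable (adj? x y) (λ x≁y → refute x≢y x≁y l)) adj⇒alternate
  where
  open Graph G
  w = word G c proper

  adj⇒alternate : ∀ {x y} → Adj x y → Alternate x y w
  adj⇒alternate {x} {y} xy with <-cmp (c x) (c y)
  ... | tri< x<y _ _ = adjacent-alternate G c proper xy x<y
  ... | tri≈ _ x≡y _ = contradiction x≡y (proper x y xy)
  ... | tri> _ _ y<x = Alternate-sym w (adjacent-alternate G c proper (adj-sym xy) y<x)

  refute : ∀ {x y} → x ≢ y → ¬ Adj x y → ¬ Alternate x y w
  refute {x} {y} x≢y x≁y with c x ≟ 1F | c y ≟ 1F
  ... | no x≢1 | _       = nonadjacent-¬alternate G c proper x≢y x≁y (inj₁ x≢1)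
  ... | yes _  | yes y≡1 = nonadjacent-¬alternate G c proper x≢y x≁y (inj₂ y≡1)
  -- The block of `x` does not separate these two, but `y` lacks the middle colour, so its own block
  -- does.
  ... | yes _  | no y≢1  =
    nonadjacent-¬alternate G c proper (≢-sym x≢y) (x≁y ∘ adj-sym) (inj₁ y≢1) ∘ Alternate-sym w

theorem2 : (n : ℕ) (G : Graph n) (P : PlaneEmbedding G) →
    IsNearTriangulation P → ¬ InducedSubgraph (K 4) G →
    Colourable 3 G ⇔ WordRepresentable G
theorem2 n G P triangulated ¬K₄ = mk⇔
  (3-colourable⇒word-representable {G = G})
  (word-representable⇒3-colourable P triangulated ¬K₄)
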